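{- Every universal theory admitting quantifier elimination is equality interpolating.
   Context: A theory is universal if it is axiomatizable by universal sentences; it admits quantifier elimination if every formula is equivalent modulo the theory to a quantifier-free formula with the same free variables. For tuples of terms $\underline u,\underline w$, $\underline u\cap\underline w\neq\emptyset$ abbreviates $\bigvee_{i,j}u_i=w_j$. $T$ is equality interpolating if for all tuples of variables $\underline x,\underline z_1,\underline z_2,\underline y_1,\underline y_2$ and all quantifier-free $\delta_1(\underline x,\underline z_1,\underline y_1),\delta_2(\underline x,\underline z_2,\underline y_2)$ with $\delta_1\wedge\delta_2\vdash_T\underline y_1\cap\underline y_2\neq\emptyset$, there is a tuple of terms $\underline v(\underline x)$ with $\delta_1\wedge\delta_2\vdash_T\underline y_1\underline y_2\cap\underline v\neq\emptyset$ (where $\underline y_1\underline y_2$ is concatenation).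
   Formalization: Equality interpolation is required only when some term over x exists (x nonempty or a constant in the signature); otherwise, with nonempty domains, it fails for the theory ∀a∀b a=b in the empty signature with x empty. -}

module Defs where

open import Level using (Level; suc)
open import Data.Nat using (ℕ; _+_) renaming (suc to 1+)
open import Data.Fin using (Fin; zero; _↑ˡ_; _↑ʳ_) renaming (suc to fsuc)
open import Data.Vec using (Vec; []; _∷_; _++_; lookup; tabulate; toList) renaming (map to mapᵛ)
open import Data.List using (List; []; _∷_; map; foldr; cartesianProductWith)
open import Data.List.Membership.Propositional using (_∈_)
open import Data.Product using (_×_; ∃; ∃-syntax)
open import Function using (_∘_; _⇔_)
open import Relation.Unary using (Pred)

private variable
  ℓ : Level
  k m n : ℕ

record Signature (ℓ : Level) : Set (suc ℓ) where
  field
    Fun : ℕ → Set ℓ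
    Rel : ℕ → Set ℓ

open Signature public

-- Terms and formulas are well-scoped (de Bruijn): those over n have their
-- free variables among n given ones, so φ : Formula S n is "φ(x₁,…,xₙ)".

data Term (S : Signature ℓ) (n : ℕ) : Set ℓ where
  var : Fin n → Term S n
  fun : Fun S k → Vec (Term S n) k → Term S n

infix  8 _≐_
infixr 5 _⊃_

data Formula (S : Signature ℓ) (n : ℕ) : Set ℓ where
  ⊥′  : Formula S n
  _≐_ : Term S n → Term S n → Formula S n
  rel : Rel S k → Vec (Term S n) k → Formula S n
  _⊃_ : Formula S n → Formula S n → Formula S n
  ∀′  : Formula S (1+ n) → Formula S n

Sentence : Signature ℓ → Set ℓ
Sentence S = Formula S 0

-- A theory is given by an arbitrary set of sentences, read as axioms; it need
-- not be deductively closed.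
Theory : Signature ℓ → Set (suc ℓ)
Theory {ℓ} S = Pred (Sentence S) ℓ

-- The logic is classical, so the remaining connectives are abbreviations.

infixr 7 _∧′_
infixr 6 _∨′_
infix  4 _≣_

¬′_ : {S : Signature ℓ} → Formula S n → Formula S n
¬′ φ = φ ⊃ ⊥′

_∧′_ _∨′_ _≣_ : {S : Signature ℓ} → Formula S n → Formula S n → Formula S n
φ ∧′ ψ = ¬′ (φ ⊃ ¬′ ψ)
φ ∨′ ψ = (¬′ φ) ⊃ ψ
φ ≣ ψ  = (φ ⊃ ψ) ∧′ (ψ ⊃ φ)

⋁ : {S : Signature ℓ} → List (Formula S n) → Formula S n
⋁ = foldr _∨′_ ⊥′

Sub : Signature ℓ → ℕ → ℕ → Set ℓ
Sub S m n = Fin m → Term S n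

subᵗ  : {S : Signature ℓ} → Sub S m n → Term S m → Term S n
subᵗˢ : {S : Signature ℓ} → Sub S m n → Vec (Term S m) k → Vec (Term S n) k
subᵗ σ (var i)    = σ i
subᵗ σ (fun f ts) = fun f (subᵗˢ σ ts)
subᵗˢ σ []       = []
subᵗˢ σ (t ∷ ts) = subᵗ σ t ∷ subᵗˢ σ ts

lift : {S : Signature ℓ} → Sub S m n → Sub S (1+ m) (1+ n)
lift σ zero     = var zero
lift σ (fsuc i) = subᵗ (var ∘ fsuc) (σ i)

sub : {S : Signature ℓ} → Sub S m n → Formula S m → Formula S n
sub σ ⊥′         = ⊥′
sub σ (s ≐ t)    = subᵗ σ s ≐ subᵗ σ t
sub σ (rel r ts) = rel r (subᵗˢ σ ts)
sub σ (φ ⊃ ψ)    = sub σ φ ⊃ sub σ ψ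
sub σ (∀′ φ)     = ∀′ (sub (lift σ) φ)

wk : {S : Signature ℓ} → Formula S n → Formula S (1+ n)
wk = sub (var ∘ fsuc)

closed : {S : Signature ℓ} → Sentence S → Formula S n
closed = sub (λ ())

infixl 9 _⟨_⟩ _[_]

-- φ ⟨ t₁ … tₘ ⟩ is φ(t₁,…,tₘ).
_⟨_⟩ : {S : Signature ℓ} → Formula S m → Vec (Term S n) m → Formula S n
φ ⟨ ts ⟩ = sub (lookup ts) φ

_[_] : {S : Signature ℓ} → Formula S (1+ n) → Term S n → Formula S n
φ [ t ] = φ ⟨ t ∷ tabulate var ⟩

-- Natural deduction for classical first-order logic with equality. By Gödel's
-- completeness theorem, T ∣ Γ ⊢ φ says that, in every model of T, each
-- assignment of the n free variables satisfying Γ satisfies φ. The rule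
-- `inhabited` expresses the usual convention that domains are nonempty: it is
-- derivable as soon as there is a term over n variables, but not otherwise.

infix 3 _∣_⊢_

data _∣_⊢_ {S : Signature ℓ} (T : Theory S) :
           {n : ℕ} → List (Formula S n) → Formula S n → Set ℓ where
  axiom     : {Γ : List (Formula S n)} {φ : Sentence S} →
              T φ → T ∣ Γ ⊢ closed φ
  hyp       : {Γ : List (Formula S n)} {φ : Formula S n} →
              φ ∈ Γ → T ∣ Γ ⊢ φ
  ⊃-intro   : {Γ : List (Formula S n)} {φ ψ : Formula S n} →
              T ∣ φ ∷ Γ ⊢ ψ → T ∣ Γ ⊢ φ ⊃ ψ
  ⊃-elim    : {Γ : List (Formula S n)} {φ ψ : Formula S n} →
              T ∣ Γ ⊢ φ ⊃ ψ → T ∣ Γ ⊢ φ → T ∣ Γ ⊢ ψ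
  raa       : {Γ : List (Formula S n)} {φ : Formula S n} →
              T ∣ ¬′ φ ∷ Γ ⊢ ⊥′ → T ∣ Γ ⊢ φ
  ∀-intro   : {Γ : List (Formula S n)} {φ : Formula S (1+ n)} →
              T ∣ map wk Γ ⊢ φ → T ∣ Γ ⊢ ∀′ φ
  ∀-elim    : {Γ : List (Formula S n)} {φ : Formula S (1+ n)} →
              T ∣ Γ ⊢ ∀′ φ → (t : Term S n) → T ∣ Γ ⊢ φ [ t ]
  ≐-refl    : {Γ : List (Formula S n)} {t : Term S n} →
              T ∣ Γ ⊢ t ≐ t
  ≐-subst   : {Γ : List (Formula S n)} (φ : Formula S (1+ n)) {s t : Term S n} →
              T ∣ Γ ⊢ s ≐ t → T ∣ Γ ⊢ φ [ s ] → T ∣ Γ ⊢ φ [ t ]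
  inhabited : {Γ : List (Formula S n)} {φ : Formula S n} →
              T ∣ map wk Γ ⊢ wk φ → T ∣ Γ ⊢ φ

data QuantifierFree {S : Signature ℓ} {n : ℕ} : Formula S n → Set ℓ where
  ⊥′  : QuantifierFree ⊥′
  _≐_ : (s t : Term S n) → QuantifierFree (s ≐ t)
  rel : (r : Rel S k) (ts : Vec (Term S n) k) → QuantifierFree (rel r ts)
  _⊃_ : {φ ψ : Formula S n} →
        QuantifierFree φ → QuantifierFree ψ → QuantifierFree (φ ⊃ ψ)

data UniversalFormula {S : Signature ℓ} : {n : ℕ} → Formula S n → Set ℓ where
  matrix : {φ : Formula S n} → QuantifierFree φ → UniversalFormula φ
  ∀′     : {φ : Formula S (1+ n)} → UniversalFormula φ → UniversalFormula (∀′ φ)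

Universal : {S : Signature ℓ} → Theory S → Set (suc ℓ)
Universal {S = S} T =
  ∃ λ (U : Theory S) → (∀ (φ : Sentence S) → U φ → UniversalFormula φ)
                     × (∀ (φ : Sentence S) → (T ∣ [] ⊢ φ) ⇔ (U ∣ [] ⊢ φ))

QuantifierElimination : {S : Signature ℓ} → Theory S → Set ℓ
QuantifierElimination {S = S} T =
  ∀ {n} (φ : Formula S n) →
  ∃[ ψ ] QuantifierFree ψ × (T ∣ [] ⊢ φ ≣ ψ)

infix 8 _∩_≠∅

_∩_≠∅ : {S : Signature ℓ} → Vec (Term S n) k → Vec (Term S n) m → Formula S n
u ∩ w ≠∅ = ⋁ (cartesianProductWith _≐_ (toList u) (toList w))

-- The five tuples of variables are consecutive blocks of the variables of one
-- common context.
module Blocks (S : Signature ℓ) (nx nz₁ nz₂ ny₁ ny₂ : ℕ) where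

  N : ℕ
  N = nx + (nz₁ + (nz₂ + (ny₁ + ny₂)))

  x : Vec (Term S N) nx
  x = tabulate λ i → var (i ↑ˡ _)

  z₁ : Vec (Term S N) nz₁
  z₁ = tabulate λ i → var (nx ↑ʳ (i ↑ˡ _))

  z₂ : Vec (Term S N) nz₂
  z₂ = tabulate λ i → var (nx ↑ʳ (nz₁ ↑ʳ (i ↑ˡ _)))

  y₁ : Vec (Term S N) ny₁
  y₁ = tabulate λ i → var (nx ↑ʳ (nz₁ ↑ʳ (nz₂ ↑ʳ (i ↑ˡ _))))

  y₂ : Vec (Term S N) ny₂
  y₂ = tabulate λ i → var (nx ↑ʳ (nz₁ ↑ʳ (nz₂ ↑ʳ (ny₁ ↑ʳ i))))

-- The argument `Term S nx` only excludes the degenerate case in which there are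
-- no terms v(x) at all, i.e. x is empty and S has no constant. As domains are
-- nonempty, that case must be excluded: the theory of the one-element set,
-- {∀a b. a = b} in the empty signature, is universal and has quantifier
-- elimination, and it proves y₁ = y₂ for single variables y₁, y₂, but with x
-- empty the only v(x) is the empty tuple.
EqualityInterpolating : {S : Signature ℓ} → Theory S → Set ℓ
EqualityInterpolating {S = S} T =
  ∀ (nx nz₁ nz₂ ny₁ ny₂ : ℕ) → Term S nx →
  let open Blocks S nx nz₁ nz₂ ny₁ ny₂ in
  (δ₁ : Formula S (nx + (nz₁ + ny₁))) → QuantifierFree δ₁ →
  (δ₂ : Formula S (nx + (nz₂ + ny₂))) → QuantifierFree δ₂ →
  let δ = δ₁ ⟨ x ++ (z₁ ++ y₁) ⟩ ∧′ δ₂ ⟨ x ++ (z₂ ++ y₂) ⟩ in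
  T ∣ δ ∷ [] ⊢ y₁ ∩ y₂ ≠∅ →
  ∃[ k ] ∃ λ (v : Vec (Term S nx) k) →
    T ∣ δ ∷ [] ⊢ (y₁ ++ y₂) ∩ mapᵛ (subᵗ (lookup x)) v ≠∅

{-# OPTIONS --safe #-}
-- Let θ(x) be a quantifier-free equivalent of ∀z₂y₂ ¬δ₂. As T is universal,
-- Herbrand's theorem turns ¬θ ⊢ ∃z₂y₂ δ₂ into ¬θ ⊢ ⋁ⱼ δ₂(x,tⱼ,sⱼ) with terms
-- tⱼ(x), sⱼ(x). Given δ₁ ∧ δ₂ we have ¬θ, hence δ₂(x,tⱼ,sⱼ) for some j, and the
-- hypothesis with (z₂,y₂) := (tⱼ,sⱼ) makes y₁ meet sⱼ. So all the entries of the
-- sⱼ together form the required v.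
--
-- Herbrand's theorem is proved by forcing over the term model: a condition is a
-- list of formulas, and an atom is forced if it is derivable up to a finite
-- disjunction of instances of δ₂.
module Submission where

open import Level using (Level)
open import Data.Nat using (ℕ; _+_) renaming (suc to 1+)
open import Data.Fin using (Fin; zero; _↑ˡ_; _↑ʳ_) renaming (suc to fsuc)
open import Data.Vec using (Vec; []; _∷_; _++_; lookup; tabulate; toList; fromList; take; drop)
  renaming (map to mapᵛ)
open import Data.Vec.Properties
  using (lookup-map; map-++; tabulate-∘; tabulate-cong; tabulate∘lookup; lookup∘tabulate;
         lookup-++ˡ; lookup-++ʳ; toList-++; toList-map; toList∘fromList; take++drop≡id)
open import Data.List using (List; []; _∷_; length; map; concatMap; cartesianProductWith)
  renaming (_++_ to _++ˡ_)
open import Data.List.Properties using (map-cong) renaming (map-∘ to mapˡ-∘; map-++ to mapˡ-++)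
open import Data.List.Membership.Propositional using (_∈_; lose)
open import Data.List.Membership.Propositional.Properties
  using (∈-map⁺; ∈-map⁻; ∈-++⁺ˡ; ∈-concatMap⁺; ∈-cartesianProductWith⁺; ∈-cartesianProductWith⁻)
open import Data.List.Relation.Binary.Subset.Propositional using (_⊆_)
open import Data.List.Relation.Binary.Subset.Propositional.Properties
  using (map⁺; ∷⁺ʳ; xs⊆xs++ys; xs⊆ys++xs; ⊆-refl; ⊆-trans)
open import Data.List.Relation.Unary.All using (All; []; _∷_) renaming (map to mapᴬ; lookup to lookupᴬ)
import Data.List.Relation.Unary.All.Properties as All
open import Data.List.Relation.Unary.Any using (here; there)
open import Data.Product using (_,_; proj₁; proj₂; ∃-syntax)
open import Function using (_∘_; _⇔_; mk⇔; Equivalence)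
open import Relation.Binary.PropositionalEquality
  using (_≡_; refl; sym; trans; cong; cong₂; subst; module ≡-Reasoning)
open import Defs

private variable
  ℓ : Level
  k m n p : ℕ
  S : Signature ℓ
  T : Theory S
  Γ Δ : List (Formula S n)
  φ ψ χ : Formula S n

-- Substitution

-- The composite is any `υ` that agrees pointwise with `σ` followed by `τ`. Substitutions are
-- functions, so this form avoids function extensionality, and callers can choose a convenient `υ`.
subᵗ-∘ : {σ : Sub S m n} {τ : Sub S n p} {υ : Sub S m p} →
         (∀ i → subᵗ τ (σ i) ≡ υ i) → ∀ t → subᵗ τ (subᵗ σ t) ≡ subᵗ υ t
subᵗˢ-∘ : {σ : Sub S m n} {τ : Sub S n p} {υ : Sub S m p} →
          (∀ i → subᵗ τ (σ i) ≡ υ i) →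
          (ts : Vec (Term S m) k) → subᵗˢ τ (subᵗˢ σ ts) ≡ subᵗˢ υ ts
subᵗ-∘ h (var i)    = h i
subᵗ-∘ h (fun f ts) = cong (fun f) (subᵗˢ-∘ h ts)
subᵗˢ-∘ h []       = refl
subᵗˢ-∘ h (t ∷ ts) = cong₂ _∷_ (subᵗ-∘ h t) (subᵗˢ-∘ h ts)

subᵗ-id : {σ : Sub S n n} → (∀ i → σ i ≡ var i) → ∀ t → subᵗ σ t ≡ t
subᵗˢ-id : {σ : Sub S n n} → (∀ i → σ i ≡ var i) →
           (ts : Vec (Term S n) k) → subᵗˢ σ ts ≡ ts
subᵗ-id h (var i)    = h i
subᵗ-id h (fun f ts) = cong (fun f) (subᵗˢ-id h ts)
subᵗˢ-id h []       = refl
subᵗˢ-id h (t ∷ ts) = cong₂ _∷_ (subᵗ-id h t) (subᵗˢ-id h ts)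

lift-∘ : {σ : Sub S m n} {τ : Sub S n p} {υ : Sub S m p} →
         (∀ i → subᵗ τ (σ i) ≡ υ i) → ∀ i → subᵗ (lift τ) (lift σ i) ≡ lift υ i
lift-∘ h zero = refl
lift-∘ {σ = σ} {τ} {υ} h (fsuc i) = begin
  subᵗ (lift τ) (subᵗ (var ∘ fsuc) (σ i)) ≡⟨ subᵗ-∘ (λ _ → refl) (σ i) ⟩
  subᵗ (subᵗ (var ∘ fsuc) ∘ τ) (σ i)      ≡⟨ subᵗ-∘ (λ _ → refl) (σ i) ⟨
  subᵗ (var ∘ fsuc) (subᵗ τ (σ i))        ≡⟨ cong (subᵗ (var ∘ fsuc)) (h i) ⟩
  subᵗ (var ∘ fsuc) (υ i)                 ∎
  where open ≡-Reasoning

sub-∘ : {σ : Sub S m n} {τ : Sub S n p} {υ : Sub S m p} →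
        (∀ i → subᵗ τ (σ i) ≡ υ i) → ∀ φ → sub τ (sub σ φ) ≡ sub υ φ
sub-∘ h ⊥′         = refl
sub-∘ h (s ≐ t)    = cong₂ _≐_ (subᵗ-∘ h s) (subᵗ-∘ h t)
sub-∘ h (rel r ts) = cong (rel r) (subᵗˢ-∘ h ts)
sub-∘ h (φ ⊃ ψ)    = cong₂ _⊃_ (sub-∘ h φ) (sub-∘ h ψ)
sub-∘ h (∀′ φ)     = cong ∀′ (sub-∘ (lift-∘ h) φ)

lift-id : {σ : Sub S n n} → (∀ i → σ i ≡ var i) → ∀ i → lift σ i ≡ var i
lift-id h zero     = refl
lift-id h (fsuc i) = cong (subᵗ (var ∘ fsuc)) (h i)

sub-id : {σ : Sub S n n} → (∀ i → σ i ≡ var i) → ∀ φ → sub σ φ ≡ φ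
sub-id h ⊥′         = refl
sub-id h (s ≐ t)    = cong₂ _≐_ (subᵗ-id h s) (subᵗ-id h t)
sub-id h (rel r ts) = cong (rel r) (subᵗˢ-id h ts)
sub-id h (φ ⊃ ψ)    = cong₂ _⊃_ (sub-id h φ) (sub-id h ψ)
sub-id h (∀′ φ)     = cong ∀′ (sub-id (lift-id h) φ)

sub-wk : (σ : Sub S m n) (φ : Formula S m) → sub (lift σ) (wk φ) ≡ wk (sub σ φ)
sub-wk σ φ = trans (sub-∘ (λ _ → refl) φ) (sym (sub-∘ (λ _ → refl) φ))

map-sub-wk : (σ : Sub S m n) (Γ : List (Formula S m)) →
             map (sub (lift σ)) (map wk Γ) ≡ map wk (map (sub σ) Γ)
map-sub-wk σ Γ = begin
  map (sub (lift σ)) (map wk Γ) ≡⟨ mapˡ-∘ Γ ⟨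
  map (sub (lift σ) ∘ wk) Γ     ≡⟨ map-cong (sub-wk σ) Γ ⟩
  map (wk ∘ sub σ) Γ            ≡⟨ mapˡ-∘ Γ ⟩
  map wk (map (sub σ) Γ)        ∎
  where open ≡-Reasoning

sub-closed : (σ : Sub S m n) (φ : Sentence S) → sub σ (closed φ) ≡ closed φ
sub-closed σ = sub-∘ (λ ())

inst-wk : (t s : Term S n) → subᵗ (lookup (t ∷ tabulate var)) (subᵗ (var ∘ fsuc) s) ≡ s
inst-wk t s = trans (subᵗ-∘ (lookup∘tabulate var) s) (subᵗ-id (λ _ → refl) s)

-- Going under a binder with `σ` and then filling the bound variable with `t` is one simultaneous
-- substitution. This is what lets vectors of terms grow one entry at a time when quantifiers are
-- eliminated.
inst-lift : (σ : Sub S m n) (t : Term S n) (φ : Formula S (1+ m)) {υ : Sub S (1+ m) n} →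
            t ≡ υ zero → (∀ i → σ i ≡ υ (fsuc i)) → sub (lift σ) φ [ t ] ≡ sub υ φ
inst-lift σ t φ t≡ σ≡ = sub-∘ (λ { zero → t≡ ; (fsuc i) → trans (inst-wk t (σ i)) (σ≡ i) }) φ

sub-inst : (σ : Sub S m n) (φ : Formula S (1+ m)) (t : Term S m) →
           sub σ (φ [ t ]) ≡ sub (lift σ) φ [ subᵗ σ t ]
sub-inst σ φ t = trans
  (sub-∘ (λ _ → refl) φ)
  (sym (inst-lift σ (subᵗ σ t) φ refl (λ i → cong (subᵗ σ) (sym (lookup∘tabulate var i)))))

sub-⟨⟩ : (σ : Sub S n p) (φ : Formula S m) (ts : Vec (Term S n) m) →
         sub σ (φ ⟨ ts ⟩) ≡ φ ⟨ mapᵛ (subᵗ σ) ts ⟩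
sub-⟨⟩ σ φ ts = sub-∘ (λ i → sym (lookup-map i (subᵗ σ) ts)) φ

sub-⋁ : (σ : Sub S m n) (φs : List (Formula S m)) → sub σ (⋁ φs) ≡ ⋁ (map (sub σ) φs)
sub-⋁ σ []       = refl
sub-⋁ σ (φ ∷ φs) = cong (¬′ (sub σ φ) ⊃_) (sub-⋁ σ φs)

map-sub-≐ : (σ : Sub S m n) (us ws : List (Term S m)) →
            map (sub σ) (cartesianProductWith _≐_ us ws) ≡
            cartesianProductWith _≐_ (map (subᵗ σ) us) (map (subᵗ σ) ws)
map-sub-≐ σ []       ws = refl
map-sub-≐ σ (u ∷ us) ws = begin
  map (sub σ) (map (u ≐_) ws ++ˡ cartesianProductWith _≐_ us ws)
    ≡⟨ mapˡ-++ (sub σ) (map (u ≐_) ws) _ ⟩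
  map (sub σ) (map (u ≐_) ws) ++ˡ map (sub σ) (cartesianProductWith _≐_ us ws)
    ≡⟨ cong₂ _++ˡ_ (trans (sym (mapˡ-∘ ws)) (mapˡ-∘ ws)) (map-sub-≐ σ us ws) ⟩
  map (subᵗ σ u ≐_) (map (subᵗ σ) ws) ++ˡ
  cartesianProductWith _≐_ (map (subᵗ σ) us) (map (subᵗ σ) ws) ∎
  where open ≡-Reasoning

sub-∩ : (σ : Sub S m n) (u : Vec (Term S m) k) (w : Vec (Term S m) p) →
        sub σ (u ∩ w ≠∅) ≡ mapᵛ (subᵗ σ) u ∩ mapᵛ (subᵗ σ) w ≠∅
sub-∩ σ u w rewrite toList-map (subᵗ σ) u | toList-map (subᵗ σ) w =
  trans (sub-⋁ σ (cartesianProductWith _≐_ (toList u) (toList w)))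
        (cong ⋁ (map-sub-≐ σ (toList u) (toList w)))

map-tabulate-var : (σ : Sub S m n) (f : Fin k → Fin m) (ts : Vec (Term S n) k) →
                   (∀ i → σ (f i) ≡ lookup ts i) →
                   mapᵛ (subᵗ σ) (tabulate (var ∘ f)) ≡ ts
map-tabulate-var σ f ts h = begin
  mapᵛ (subᵗ σ) (tabulate (var ∘ f)) ≡⟨ tabulate-∘ (subᵗ σ) (var ∘ f) ⟨
  tabulate (σ ∘ f)                   ≡⟨ tabulate-cong h ⟩
  tabulate (lookup ts)               ≡⟨ tabulate∘lookup ts ⟩
  ts                                 ∎
  where open ≡-Reasoning

-- Derivations

⊢-cast : φ ≡ ψ → T ∣ Γ ⊢ φ → T ∣ Γ ⊢ ψ
⊢-cast refl d = d

⊢-castˡ : Γ ≡ Δ → T ∣ Γ ⊢ φ → T ∣ Δ ⊢ φ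
⊢-castˡ refl d = d

weaken : Γ ⊆ Δ → T ∣ Γ ⊢ φ → T ∣ Δ ⊢ φ
weaken Γ⊆Δ (axiom φ∈T)     = axiom φ∈T
weaken Γ⊆Δ (hyp φ∈Γ)       = hyp (Γ⊆Δ φ∈Γ)
weaken Γ⊆Δ (⊃-intro d)     = ⊃-intro (weaken (∷⁺ʳ _ Γ⊆Δ) d)
weaken Γ⊆Δ (⊃-elim d e)    = ⊃-elim (weaken Γ⊆Δ d) (weaken Γ⊆Δ e)
weaken Γ⊆Δ (raa d)         = raa (weaken (∷⁺ʳ _ Γ⊆Δ) d)
weaken Γ⊆Δ (∀-intro d)     = ∀-intro (weaken (map⁺ wk Γ⊆Δ) d)
weaken Γ⊆Δ (∀-elim d t)    = ∀-elim (weaken Γ⊆Δ d) t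
weaken Γ⊆Δ ≐-refl          = ≐-refl
weaken Γ⊆Δ (≐-subst φ d e) = ≐-subst φ (weaken Γ⊆Δ d) (weaken Γ⊆Δ e)
weaken Γ⊆Δ (inhabited d)   = inhabited (weaken (map⁺ wk Γ⊆Δ) d)

weaken₁ : T ∣ Γ ⊢ φ → T ∣ ψ ∷ Γ ⊢ φ
weaken₁ = weaken there

⊢-sub : (σ : Sub S m n) {Γ : List (Formula S m)} {φ : Formula S m} →
        T ∣ Γ ⊢ φ → T ∣ map (sub σ) Γ ⊢ sub σ φ
⊢-sub σ (axiom {φ = φ} φ∈T) = ⊢-cast (sym (sub-closed σ φ)) (axiom φ∈T)
⊢-sub σ (hyp φ∈Γ)    = hyp (∈-map⁺ (sub σ) φ∈Γ)
⊢-sub σ (⊃-intro d)  = ⊃-intro (⊢-sub σ d)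
⊢-sub σ (⊃-elim d e) = ⊃-elim (⊢-sub σ d) (⊢-sub σ e)
⊢-sub σ (raa d)      = raa (⊢-sub σ d)
⊢-sub σ (∀-intro {Γ = Γ} d) =
  ∀-intro (⊢-castˡ (map-sub-wk σ Γ) (⊢-sub (lift σ) d))
⊢-sub σ (∀-elim {φ = φ} d t) =
  ⊢-cast (sym (sub-inst σ φ t)) (∀-elim (⊢-sub σ d) (subᵗ σ t))
⊢-sub σ ≐-refl = ≐-refl
⊢-sub σ (≐-subst φ {s} {t} d e) =
  ⊢-cast (sym (sub-inst σ φ t))
    (≐-subst (sub (lift σ) φ) (⊢-sub σ d)
      (⊢-cast (sub-inst σ φ s) (⊢-sub σ e)))
⊢-sub σ (inhabited {Γ = Γ} {φ} d) =
  inhabited (⊢-castˡ (map-sub-wk σ Γ)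
    (⊢-cast (sub-wk σ φ) (⊢-sub (lift σ) d)))

-- Derived rules of classical propositional logic

cut : T ∣ Γ ⊢ φ → T ∣ φ ∷ Γ ⊢ ψ → T ∣ Γ ⊢ ψ
cut d e = ⊃-elim (⊃-intro e) d

efq : T ∣ Γ ⊢ ⊥′ → T ∣ Γ ⊢ φ
efq d = raa (weaken₁ d)

dne : T ∣ Γ ⊢ ¬′ ¬′ φ → T ∣ Γ ⊢ φ
dne d = raa (⊃-elim (weaken₁ d) (hyp (here refl)))

∧-intro : T ∣ Γ ⊢ φ → T ∣ Γ ⊢ ψ → T ∣ Γ ⊢ φ ∧′ ψ
∧-intro d e = ⊃-intro (⊃-elim (⊃-elim (hyp (here refl)) (weaken₁ d)) (weaken₁ e))

∧-elimˡ : T ∣ Γ ⊢ φ ∧′ ψ → T ∣ Γ ⊢ φ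
∧-elimˡ d = raa (⊃-elim (weaken₁ d)
  (⊃-intro (efq (⊃-elim (hyp (there (here refl))) (hyp (here refl))))))

∧-elimʳ : T ∣ Γ ⊢ φ ∧′ ψ → T ∣ Γ ⊢ ψ
∧-elimʳ d = raa (⊃-elim (weaken₁ d) (⊃-intro (hyp (there (here refl)))))

∨-introˡ : T ∣ Γ ⊢ φ → T ∣ Γ ⊢ φ ∨′ ψ
∨-introˡ d = ⊃-intro (efq (⊃-elim (hyp (here refl)) (weaken₁ d)))

⋁-intro : {φs : List (Formula S n)} → φ ∈ φs → T ∣ Γ ⊢ φ → T ∣ Γ ⊢ ⋁ φs
⋁-intro (here refl) d = ∨-introˡ d
⋁-intro (there φ∈)  d = ⊃-intro (weaken₁ (⋁-intro φ∈ d))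

⋁-elim : {φs : List (Formula S n)} → T ∣ Γ ⊢ ⋁ φs →
         (∀ {φ} → φ ∈ φs → T ∣ φ ∷ Γ ⊢ ψ) → T ∣ Γ ⊢ ψ
⋁-elim {φs = []}     d h = efq d
-- Assume the negation of the goal. The first disjunct is then refuted by its own case, so the
-- remaining disjunction holds and the induction applies to it. Each `∷⁺ʳ _ there` slips the negated
-- goal beneath the disjunct assumed in a case.
⋁-elim {φs = φ ∷ φs} d h = raa (⊃-elim (hyp (here refl))
  (⋁-elim (⊃-elim (weaken₁ d)
                  (⊃-intro (⊃-elim (hyp (there (here refl))) (weaken (∷⁺ʳ _ there) (h (here refl))))))
          (λ ψ∈ → weaken (∷⁺ʳ _ there) (h (there ψ∈)))))

⊢-sub-closed : (σ : Sub S 0 n) {φ : Sentence S} → T ∣ [] ⊢ φ → T ∣ Γ ⊢ sub σ φ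
⊢-sub-closed σ d = weaken (λ ()) (⊢-sub σ d)

∀ⁿ : ∀ m → Formula S (m + n) → Formula S n
∀ⁿ 0      φ = φ
∀ⁿ (1+ m) φ = ∀ⁿ m (∀′ φ)

∀ⁿ-elim : (σ : Vec (Term S n) k) (ts : Vec (Term S n) m) {φ : Formula S (m + k)} →
          T ∣ Γ ⊢ ∀ⁿ m φ ⟨ σ ⟩ → T ∣ Γ ⊢ φ ⟨ ts ++ σ ⟩
∀ⁿ-elim σ []       d = d
∀ⁿ-elim σ (t ∷ ts) {φ} d =
  ⊢-cast (inst-lift (lookup (ts ++ σ)) t φ refl (λ _ → refl))
    (∀-elim (∀ⁿ-elim σ ts d) t)

-- Herbrand's theorem by forcing

-- The number `n` of variables is fixed: the terms over `n` form the domain of the term model, and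
-- `t₀` witnesses that it is nonempty. The formulas `D i` are the exceptions up to which atoms are
-- forced.
module Forcing {S : Signature ℓ} (T : Theory S) {I : Set ℓ} (D : I → Formula S n)
               (t₀ : Term S n) where

  -- Derivability up to finitely many exceptions

  Almost : Formula S n → List (Formula S n) → Set ℓ
  Almost χ Γ = ∃[ is ] T ∣ Γ ⊢ ⋁ (χ ∷ map D is)

  pure : T ∣ Γ ⊢ χ → Almost χ Γ
  pure d = [] , ∨-introˡ d

  almost-mono : Γ ⊆ Δ → Almost χ Γ → Almost χ Δ
  almost-mono Γ⊆Δ (is , d) = is , weaken Γ⊆Δ d

  almost-bind : Almost φ Γ → Almost ψ (φ ∷ Γ) → Almost ψ Γ
  almost-bind (is , d) (js , e) = is ++ˡ js , ⋁-elim d λ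
    { (here refl) → ⋁-elim e λ χ∈ →
        ⋁-intro (∷⁺ʳ _ (map⁺ D (xs⊆ys++xs js is)) χ∈) (hyp (here refl))
    ; (there χ∈)  → ⋁-intro (there (map⁺ D (xs⊆xs++ys is js) χ∈)) (hyp (here refl)) }

  almost-map : Almost φ Γ → T ∣ φ ∷ Γ ⊢ ψ → Almost ψ Γ
  almost-map a d = almost-bind a (pure d)

  almost-app : Almost (φ ⊃ ψ) Γ → Almost φ Γ → Almost ψ Γ
  almost-app a b = almost-bind a (almost-map (almost-mono there b)
    (⊃-elim (hyp (there (here refl))) (hyp (here refl))))

  -- The exceptions found under the hypothesis `φ` also serve without it. If the target disjunction
  -- failed, every exception would be excluded, so `φ` would yield `ψ`; but then `φ ⊃ ψ`, the first
  -- disjunct, holds.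
  almost-abs : Almost ψ (φ ∷ Γ) → Almost (φ ⊃ ψ) Γ
  almost-abs {φ = φ} (is , d) = is , raa
    (cut (⊃-intro (⋁-elim {φs = _ ∷ map D is} (weaken (∷⁺ʳ φ there) d) λ
        { (here refl) → hyp (here refl)
        ; (there χ∈)  → efq (⊃-elim (hyp (there (there (here refl))))
                                    (⊃-intro (weaken₁ (⋁-intro {φs = map D is} χ∈ (hyp (here refl)))))) }))
      (⊃-elim (hyp (there (here refl))) (∨-introˡ (hyp (here refl)))))

  -- The forcing relation

  infix 3 _⊩_∙_

  -- Kripke forcing with conditions ordered by inclusion and with `ρ` evaluating the free variables.
  -- The domain of terms is the same at every condition, so only implication has to look at larger
  -- conditions. Falsity is also taken up to exceptions, as stability of atoms requires.
  _⊩_∙_ : List (Formula S n) → Formula S k → Vec (Term S n) k → Set ℓ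
  Γ ⊩ ⊥′ ∙ ρ       = Almost ⊥′ Γ
  Γ ⊩ s ≐ t ∙ ρ    = Almost ((s ≐ t) ⟨ ρ ⟩) Γ
  Γ ⊩ rel r ts ∙ ρ = Almost (rel r ts ⟨ ρ ⟩) Γ
  Γ ⊩ φ ⊃ ψ ∙ ρ    = ∀ Δ → Γ ⊆ Δ → Δ ⊩ φ ∙ ρ → Δ ⊩ ψ ∙ ρ
  Γ ⊩ ∀′ φ ∙ ρ     = ∀ t → Γ ⊩ φ ∙ t ∷ ρ

  ⊩-mono : ∀ (φ : Formula S k) {ρ} → Γ ⊆ Δ → Γ ⊩ φ ∙ ρ → Δ ⊩ φ ∙ ρ
  ⊩-mono ⊥′         Γ⊆Δ = almost-mono Γ⊆Δ
  ⊩-mono (s ≐ t)    Γ⊆Δ = almost-mono Γ⊆Δ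
  ⊩-mono (rel r ts) Γ⊆Δ = almost-mono Γ⊆Δ
  ⊩-mono (φ ⊃ ψ)    Γ⊆Δ f Ε Δ⊆Ε = f Ε (⊆-trans Γ⊆Δ Δ⊆Ε)
  ⊩-mono (∀′ φ)     Γ⊆Δ f t = ⊩-mono φ Γ⊆Δ (f t)

  -- Apply `f` to the condition extended by `¬′ χ`. There any extension almost deriving `χ` almost
  -- derives falsity, so `¬′ χ` almost leads to falsity, and `almost-abs` followed by double
  -- negation elimination gives `χ`.
  almost-stable : (∀ Δ → Γ ⊆ Δ → (∀ Ε → Δ ⊆ Ε → Almost χ Ε → Almost ⊥′ Ε) → Almost ⊥′ Δ) →
                  Almost χ Γ
  almost-stable {χ = χ} f = almost-map
    (almost-abs (f (¬′ χ ∷ _) there λ Ε ⊆Ε a → almost-map a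
      (⊃-elim (hyp (there (⊆Ε (here refl)))) (hyp (here refl)))))
    (dne (hyp (here refl)))

  -- This makes forcing sound for `raa`. Stability passes from the atoms to all formulas because
  -- implication and universal quantification, the only compound forms, preserve it.
  ⊩-stable : ∀ (φ : Formula S k) {ρ} → Γ ⊩ ¬′ ¬′ φ ∙ ρ → Γ ⊩ φ ∙ ρ
  ⊩-stable ⊥′         f = almost-stable f
  ⊩-stable (s ≐ t)    f = almost-stable f
  ⊩-stable (rel r ts) f = almost-stable f
  ⊩-stable (φ ⊃ ψ) f Δ Γ⊆Δ a = ⊩-stable ψ λ Ε Δ⊆Ε g →
    f Ε (⊆-trans Γ⊆Δ Δ⊆Ε) λ Ζ Ε⊆Ζ h →
      g Ζ Ε⊆Ζ (h Ζ ⊆-refl (⊩-mono φ (⊆-trans Δ⊆Ε Ε⊆Ζ) a))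
  ⊩-stable (∀′ φ) f t = ⊩-stable φ λ Δ Γ⊆Δ g → f Δ Γ⊆Δ λ Ε Δ⊆Ε h → g Ε Δ⊆Ε (h t)

  -- An equivalence is proved because the antecedent of an implication uses the opposite direction.
  ⊩-sub : ∀ (φ : Formula S k) {σ : Sub S k m} {ρ ρ′} →
          (∀ i → subᵗ (lookup ρ) (σ i) ≡ lookup ρ′ i) →
          (Γ ⊩ sub σ φ ∙ ρ) ⇔ (Γ ⊩ φ ∙ ρ′)
  ⊩-sub ⊥′ h = mk⇔ (λ a → a) (λ a → a)
  ⊩-sub {Γ = Γ} χ@(s ≐ t) h =
    mk⇔ (subst (λ χ → Almost χ Γ) (sub-∘ h χ)) (subst (λ χ → Almost χ Γ) (sym (sub-∘ h χ)))
  ⊩-sub {Γ = Γ} χ@(rel r ts) h =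
    mk⇔ (subst (λ χ → Almost χ Γ) (sub-∘ h χ)) (subst (λ χ → Almost χ Γ) (sym (sub-∘ h χ)))
  ⊩-sub (φ ⊃ ψ) h = mk⇔
    (λ f Δ Γ⊆Δ a → Equivalence.to (⊩-sub ψ h) (f Δ Γ⊆Δ (Equivalence.from (⊩-sub φ h) a)))
    (λ f Δ Γ⊆Δ a → Equivalence.from (⊩-sub ψ h) (f Δ Γ⊆Δ (Equivalence.to (⊩-sub φ h) a)))
  ⊩-sub (∀′ φ) {σ} {ρ} {ρ′} h = mk⇔
    (λ f t → Equivalence.to (⊩-sub φ (h′ t)) (f t))
    (λ f t → Equivalence.from (⊩-sub φ (h′ t)) (f t))
    where
    h′ : ∀ t i → subᵗ (lookup (t ∷ ρ)) (lift σ i) ≡ lookup (t ∷ ρ′) i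
    h′ t zero     = refl
    h′ t (fsuc i) = trans (subᵗ-∘ (λ _ → refl) (σ i)) (h i)

  -- Equality under forcing

  almost-sym : {s t : Term S n} → Almost (s ≐ t) Γ → Almost (t ≐ s) Γ
  almost-sym {Γ = Γ} {s} {t} a = almost-map a (⊢-cast (eq t)
    (≐-subst (var zero ≐ subᵗ (var ∘ fsuc) s) (hyp (here refl))
      (⊢-cast (sym (eq s)) ≐-refl)))
    where
    eq : ∀ u → (var zero ≐ subᵗ (var ∘ fsuc) s) [ u ] ≡ (u ≐ s)
    eq u = cong (u ≐_) (inst-wk u s)

  -- Read `σ` as a tuple of terms with a hole, the variable `zero`; then `ρ` is this tuple with `t`
  -- in the hole. Two instances of the same `σ` differ just by replacing one term by another, which
  -- is what `≐-subst` can handle.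
  Instance : Sub S k (1+ n) → Term S n → Vec (Term S n) k → Set ℓ
  Instance σ t ρ = ∀ i → subᵗ (lookup (t ∷ tabulate var)) (σ i) ≡ lookup ρ i

  almost-≐ : ∀ (χ : Formula S k) σ {s t} ρ ρ′ → Almost (s ≐ t) Γ →
             Instance σ s ρ → Instance σ t ρ′ → Almost (χ ⟨ ρ ⟩) Γ → Almost (χ ⟨ ρ′ ⟩) Γ
  almost-≐ χ σ ρ ρ′ e h h′ a = almost-bind e (almost-map (almost-mono there a)
    (⊢-cast (sub-∘ h′ χ) (≐-subst (sub σ χ) (hyp (there (here refl)))
      (⊢-cast (sym (sub-∘ h χ)) (hyp (here refl))))))

  -- The Leibniz rule holds for atoms by `≐-subst` and spreads by induction. The antecedent of an
  -- implication is transported backwards, hence the appeal to symmetry.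
  ⊩-≐ : ∀ (φ : Formula S k) σ {s t} ρ ρ′ → Almost (s ≐ t) Γ →
        Instance σ s ρ → Instance σ t ρ′ → Γ ⊩ φ ∙ ρ → Γ ⊩ φ ∙ ρ′
  ⊩-≐ ⊥′           σ ρ ρ′ e h h′ a = a
  ⊩-≐ χ@(u ≐ v)    σ ρ ρ′ e h h′ = almost-≐ χ σ ρ ρ′ e h h′
  ⊩-≐ χ@(rel r ts) σ ρ ρ′ e h h′ = almost-≐ χ σ ρ ρ′ e h h′
  ⊩-≐ (φ ⊃ ψ) σ ρ ρ′ e h h′ f Δ Γ⊆Δ a =
    ⊩-≐ ψ σ ρ ρ′ (almost-mono Γ⊆Δ e) h h′
      (f Δ Γ⊆Δ (⊩-≐ φ σ ρ′ ρ (almost-sym (almost-mono Γ⊆Δ e)) h′ h a))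
  ⊩-≐ (∀′ φ) σ {s} {t} ρ ρ′ e h h′ f u =
    -- The tuple gains the entry `u`, weakened so that it does not contain the hole.
    ⊩-≐ φ (λ { zero → subᵗ (var ∘ fsuc) u ; (fsuc i) → σ i }) (u ∷ ρ) (u ∷ ρ′) e
      (λ { zero → inst-wk s u ; (fsuc i) → h i })
      (λ { zero → inst-wk t u ; (fsuc i) → h′ i }) (f u)

  ⊩-inst : ∀ (φ : Formula S (1+ k)) (t : Term S k) {ρ} →
           (Γ ⊩ φ [ t ] ∙ ρ) ⇔ (Γ ⊩ φ ∙ subᵗ (lookup ρ) t ∷ ρ)
  ⊩-inst φ t {ρ} = ⊩-sub φ
    λ { zero → refl ; (fsuc i) → cong (subᵗ (lookup ρ)) (lookup∘tabulate var i) }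

  -- The axioms U need not be those of T, whose derivability defines forcing.
  sound : {U : Theory S} → (∀ φ → U φ → ∀ Γ → Γ ⊩ φ ∙ []) →
          {Γ : List (Formula S k)} {φ : Formula S k} → U ∣ Γ ⊢ φ →
          ∀ {Δ} ρ → All (λ γ → Δ ⊩ γ ∙ ρ) Γ → Δ ⊩ φ ∙ ρ
  sound {U = U} ax = go
    where
    wk-all : {Γ : List (Formula S k)} {Δ : List (Formula S n)} {t : Term S n}
             {ρ : Vec (Term S n) k} →
             All (λ γ → Δ ⊩ γ ∙ ρ) Γ → All (λ γ → Δ ⊩ γ ∙ t ∷ ρ) (map wk Γ)
    wk-all as = All.map⁺ (mapᴬ (λ {γ} → Equivalence.from (⊩-sub γ (λ _ → refl))) as)

    go : {Γ : List (Formula S m)} {φ : Formula S m} → U ∣ Γ ⊢ φ →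
         ∀ {Δ} ρ → All (λ γ → Δ ⊩ γ ∙ ρ) Γ → Δ ⊩ φ ∙ ρ
    go (axiom {φ = φ} φ∈U) ρ as = Equivalence.from (⊩-sub φ (λ ())) (ax φ φ∈U _)
    go (hyp φ∈Γ) ρ as = lookupᴬ as φ∈Γ
    go (⊃-intro d) ρ as Δ′ Δ⊆ a = go d ρ (a ∷ mapᴬ (λ {γ} → ⊩-mono γ Δ⊆) as)
    go (⊃-elim d e) ρ as = go d ρ as _ ⊆-refl (go e ρ as)
    go (raa {φ = φ} d) ρ as =
      ⊩-stable φ λ Δ′ Δ⊆ a → go d ρ (a ∷ mapᴬ (λ {γ} → ⊩-mono γ Δ⊆) as)
    go (∀-intro d) ρ as t = go d (t ∷ ρ) (wk-all as)
    go (∀-elim {φ = φ} d t) ρ as =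
      Equivalence.from (⊩-inst φ t) (go d ρ as (subᵗ (lookup ρ) t))
    go ≐-refl ρ as = pure ≐-refl
    go (≐-subst φ {s} {t} d e) ρ as = Equivalence.from (⊩-inst φ t)
      -- The hole is the first entry alone: the entries of `ρ` are weakened and stay fixed.
      (⊩-≐ φ (λ { zero → var zero ; (fsuc i) → subᵗ (var ∘ fsuc) (lookup ρ i) })
        (subᵗ (lookup ρ) s ∷ ρ) (subᵗ (lookup ρ) t ∷ ρ) (go d ρ as)
        (λ { zero → refl ; (fsuc i) → inst-wk _ (lookup ρ i) })
        (λ { zero → refl ; (fsuc i) → inst-wk _ (lookup ρ i) })
        (Equivalence.to (⊩-inst φ s) (go e ρ as)))
    -- The extra variable is evaluated as `t₀`.
    go (inhabited {φ = φ} d) ρ as =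
      Equivalence.to (⊩-sub φ (λ _ → refl)) (go d (t₀ ∷ ρ) (wk-all as))

  -- For an implication, the condition extended by the antecedent forces the antecedent, so it
  -- almost derives the consequent, and `almost-abs` discharges the added hypothesis. The converse
  -- is almost modus ponens.
  ⊩⇔almost : {φ : Formula S k} {ρ : Vec (Term S n) k} → QuantifierFree φ →
             (Γ ⊩ φ ∙ ρ) ⇔ Almost (φ ⟨ ρ ⟩) Γ
  ⊩⇔almost ⊥′         = mk⇔ (λ a → a) (λ a → a)
  ⊩⇔almost (s ≐ t)    = mk⇔ (λ a → a) (λ a → a)
  ⊩⇔almost (rel r ts) = mk⇔ (λ a → a) (λ a → a)
  ⊩⇔almost {Γ = Γ} {φ ⊃ ψ} {ρ} (p ⊃ q) = mk⇔
    (λ f → almost-abs (Equivalence.to (⊩⇔almost q)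
      (f _ there (Equivalence.from (⊩⇔almost p) (pure (hyp (here refl)))))))
    back
    where
    back : Almost ((φ ⊃ ψ) ⟨ ρ ⟩) Γ → Γ ⊩ φ ⊃ ψ ∙ ρ
    back a Δ Γ⊆Δ b = Equivalence.from (⊩⇔almost q)
      (almost-app (almost-mono Γ⊆Δ a) (Equivalence.to (⊩⇔almost p) b))

  -- Forcing a universal formula only asks for its instances at terms, and these are derivable from
  -- the formula itself. This is how universality of the axioms enters.
  ⊩-universal : {φ : Formula S k} {ρ : Vec (Term S n) k} → UniversalFormula φ →
                T ∣ Γ ⊢ φ ⟨ ρ ⟩ → Γ ⊩ φ ∙ ρ
  ⊩-universal (matrix p) d = Equivalence.from (⊩⇔almost p) (pure d)
  ⊩-universal {ρ = ρ} (∀′ {φ = φ} u) d t = ⊩-universal u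
    (⊢-cast (inst-lift (lookup ρ) t φ refl (λ _ → refl)) (∀-elim d t))

  ⊩-∀ⁿ : ∀ m {φ : Formula S (m + k)} {ρ} → (∀ ts → Γ ⊩ φ ∙ ts ++ ρ) → Γ ⊩ ∀ⁿ m φ ∙ ρ
  ⊩-∀ⁿ 0      f = f []
  ⊩-∀ⁿ (1+ m) f = ⊩-∀ⁿ m (λ ts t → f (t ∷ ts))

  -- Soundness is used twice. The universal axioms `U` are theorems of `T`, hence forced; the axioms
  -- of `T` are theorems of `U`, hence forced by soundness for `U`; so all theorems of `T` are
  -- forced.
  universal-sound : Universal T → {φ : Formula S n} → T ∣ [] ⊢ φ → Γ ⊩ φ ∙ tabulate var
  universal-sound (U , U-universal , T⇔U) d = sound T-forced d (tabulate var) []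
    where
    closed-id : (φ : Sentence S) → closed φ ≡ φ
    closed-id = sub-id (λ ())

    ax : {V : Theory S} {φ : Sentence S} → V φ → V ∣ [] ⊢ φ
    ax {V} {φ} φ∈V = ⊢-cast (closed-id φ) (axiom φ∈V)

    U-forced : ∀ φ → U φ → ∀ Γ → Γ ⊩ φ ∙ []
    U-forced φ φ∈U Γ = ⊩-universal (U-universal φ φ∈U)
      (⊢-sub-closed (lookup []) (Equivalence.from (T⇔U φ) (ax φ∈U)))

    T-forced : ∀ φ → T φ → ∀ Γ → Γ ⊩ φ ∙ []
    T-forced φ φ∈T Γ = sound U-forced (Equivalence.to (T⇔U φ) (ax φ∈T)) [] []

-- Left transparent, the witnesses are unfolded in conversion checks, at prohibitive cost.
abstract
  herbrand : {T : Theory S} → Universal T → Term S n →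
             {φ : Formula S (m + n)} → QuantifierFree φ →
             {ψ : Formula S n} → QuantifierFree ψ → T ∣ [] ⊢ ∀ⁿ m (¬′ φ) ⊃ ψ →
             ∃[ tss ] T ∣ [] ⊢ ⋁ (ψ ∷ map (λ ts → φ ⟨ ts ++ tabulate var ⟩) tss)
  herbrand {n = n} {m = m} {T = T} T-universal t₀ {φ} φ-qf {ψ} ψ-qf d =
    subst (λ ψ → Almost ψ []) (sub-id (lookup∘tabulate var) ψ)
      (Equivalence.to (⊩⇔almost ψ-qf)
        (universal-sound T-universal d [] ⊆-refl
          -- The premise is forced at the empty condition: by excluded middle, the negated instance
          -- at `ts` holds up to the single exception `φ` at `ts`.
          (⊩-∀ⁿ m λ ts → Equivalence.from (⊩⇔almost (φ-qf ⊃ ⊥′))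
            (ts ∷ [] , ⊃-intro (∨-introˡ (dne (hyp (here refl))))))))
    where open Forcing T (λ ts → φ ⟨ ts ++ tabulate var ⟩) t₀

-- Equality interpolation

sub-qf : (σ : Sub S m n) {φ : Formula S m} → QuantifierFree φ → QuantifierFree (sub σ φ)
sub-qf σ ⊥′         = ⊥′
sub-qf σ (s ≐ t)    = subᵗ σ s ≐ subᵗ σ t
sub-qf σ (rel r ts) = rel r (subᵗˢ σ ts)
sub-qf σ (p ⊃ q)    = sub-qf σ p ⊃ sub-qf σ q

∩-mono : (u : Vec (Term S n) k) (w : Vec (Term S n) m)
         (u′ : Vec (Term S n) p) {l : ℕ} (w′ : Vec (Term S n) l) →
         toList u ⊆ toList u′ → toList w ⊆ toList w′ →
         T ∣ Γ ⊢ u ∩ w ≠∅ → T ∣ Γ ⊢ u′ ∩ w′ ≠∅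
∩-mono u w u′ w′ u⊆ w⊆ d = ⋁-elim {φs = cartesianProductWith _≐_ (toList u) (toList w)} d λ χ∈ →
  let _ , _ , a∈ , b∈ , χ≡ = ∈-cartesianProductWith⁻ _≐_ (toList u) (toList w) χ∈
  in ⋁-intro {φs = cartesianProductWith _≐_ (toList u′) (toList w′)}
       (subst (_∈ _) (sym χ≡) (∈-cartesianProductWith⁺ _≐_ (u⊆ a∈) (w⊆ b∈)))
       (hyp (here refl))

-- ∀ⁿ binds the first variables of the context, but those of δ₂ to be bound come last.
swap : ∀ n m → Vec (Term S (m + n)) (n + m)
swap n m = tabulate (var ∘ (m ↑ʳ_)) ++ tabulate (var ∘ (_↑ˡ n))

map-swap : (ρ : Vec (Term S p) n) (ts : Vec (Term S p) m) →
           mapᵛ (subᵗ (lookup (ts ++ ρ))) (swap n m) ≡ ρ ++ ts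
map-swap {n = n} {m = m} ρ ts = trans
  (map-++ _ (tabulate (var ∘ (m ↑ʳ_))) _)
  (cong₂ _++_ (map-tabulate-var _ (m ↑ʳ_) ρ (lookup-++ʳ ts ρ))
              (map-tabulate-var _ (_↑ˡ n) ts (lookup-++ˡ ts ρ)))

sub-swap : (φ : Formula S (n + m)) (ρ : Vec (Term S p) n) (ts : Vec (Term S p) m) →
           φ ⟨ swap n m ⟩ ⟨ ts ++ ρ ⟩ ≡ φ ⟨ ρ ++ ts ⟩
sub-swap {n = n} {m = m} φ ρ ts = trans (sub-⟨⟩ _ φ (swap n m)) (cong (φ ⟨_⟩) (map-swap ρ ts))

mainTheorem7 : ∀ {ℓ : Level} {S : Signature ℓ} (T : Theory S) → Universal T → QuantifierElimination T → EqualityInterpolating T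
mainTheorem7 {S = S} T T-universal qe nx nz₁ nz₂ ny₁ ny₂ t₀ δ₁ _ δ₂ δ₂-qf δ⊢ =
  _ , v , ⋁-elim {φs = θ ⟨ x ⟩ ∷ map (sub σˣ) (map D tss)} disjunction λ
    { (here refl) → refute (hyp (here refl)) (hyp (there (here refl)))
    ; (there χ∈)  → witness χ∈ }
  where
  open Blocks S nx nz₁ nz₂ ny₁ ny₂

  δ : Formula S N
  δ = δ₁ ⟨ x ++ (z₁ ++ y₁) ⟩ ∧′ δ₂ ⟨ x ++ (z₂ ++ y₂) ⟩

  m′ : ℕ
  m′ = nz₂ + ny₂

  δ₂′ : Formula S (m′ + nx)
  δ₂′ = δ₂ ⟨ swap nx m′ ⟩

  ∀¬δ₂ : Formula S nx
  ∀¬δ₂ = ∀ⁿ m′ (¬′ δ₂′)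

  θ : Formula S nx
  θ = proj₁ (qe ∀¬δ₂)

  θ-equiv : T ∣ [] ⊢ ∀¬δ₂ ≣ θ
  θ-equiv = proj₂ (proj₂ (qe ∀¬δ₂))

  D : Vec (Term S nx) m′ → Formula S nx
  D ts = δ₂′ ⟨ ts ++ tabulate var ⟩

  witnesses : ∃[ tss ] T ∣ [] ⊢ ⋁ (θ ∷ map D tss)
  witnesses = herbrand T-universal t₀ (sub-qf _ δ₂-qf) (proj₁ (proj₂ (qe ∀¬δ₂))) (∧-elimˡ θ-equiv)

  tss : List (Vec (Term S nx) m′)
  tss = proj₁ witnesses

  -- Each Herbrand tuple lists values for `z₂` and then for `y₂`. Only the latter can be compared
  -- with `y₁`, so the first `nz₂` entries are dropped.
  vs : List (Term S nx)
  vs = concatMap (toList ∘ drop nz₂) tss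

  v : Vec (Term S nx) (length vs)
  v = fromList vs

  σˣ : Sub S nx N
  σˣ = lookup x

  disjunction : T ∣ δ ∷ [] ⊢ ⋁ (θ ⟨ x ⟩ ∷ map (sub σˣ) (map D tss))
  disjunction = weaken (λ ())
    (⊢-cast (sub-⋁ σˣ (θ ∷ map D tss)) (⊢-sub σˣ (proj₂ witnesses)))

  refute : T ∣ Γ ⊢ θ ⟨ x ⟩ → T ∣ Γ ⊢ δ → T ∣ Γ ⊢ φ
  -- By the equivalence, `θ` at `x` gives the universal closure of the negation of `δ₂`, which is
  -- instantiated at the variables `z₂` and `y₂` themselves.
  refute d e = efq (⊃-elim
    (⊢-cast (cong ¬′_ (sub-swap δ₂ x (z₂ ++ y₂)))
      (∀ⁿ-elim x (z₂ ++ y₂) {¬′ δ₂′}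
        (⊃-elim (weaken (λ ()) (⊢-sub σˣ (∧-elimʳ θ-equiv))) d)))
    (∧-elimʳ e))

  -- The variables `z₂` and `y₂` do not occur in the first conjunct, so in the hypothesis `δ⊢` they
  -- may be replaced by arbitrary terms while `x`, `z₁` and `y₁` stay put.
  meet : (tz : Vec (Term S N) nz₂) (ty : Vec (Term S N) ny₂) →
         T ∣ δ₁ ⟨ x ++ (z₁ ++ y₁) ⟩ ∧′ δ₂ ⟨ x ++ (tz ++ ty) ⟩ ∷ [] ⊢ y₁ ∩ ty ≠∅
  meet tz ty = ⊢-castˡ (cong (_∷ []) (cong₂ _∧′_ δ₁≡ δ₂≡))
    (⊢-cast (trans (sub-∩ σ y₁ y₂) (cong₂ _∩_≠∅ y₁≡ y₂≡)) (⊢-sub σ δ⊢))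
    where
    σ : Sub S N N
    -- The blocks follow the order of the common context, where `z₂` precedes `y₁`; hence `tz` and
    -- `ty` are not adjacent.
    σ = lookup (x ++ (z₁ ++ (tz ++ (y₁ ++ ty))))

    σ-map : ∀ {j} → Vec (Term S N) j → Vec (Term S N) j
    σ-map = mapᵛ (subᵗ σ)

    x≡ : σ-map x ≡ x
    x≡ = map-tabulate-var σ _ x (lookup-++ˡ x _)

    z₁≡ : σ-map z₁ ≡ z₁
    z₁≡ = map-tabulate-var σ _ z₁ λ i → trans (lookup-++ʳ x _ _) (lookup-++ˡ z₁ _ i)

    z₂≡ : σ-map z₂ ≡ tz
    z₂≡ = map-tabulate-var σ _ tz λ i →
      trans (lookup-++ʳ x _ _) (trans (lookup-++ʳ z₁ _ _) (lookup-++ˡ tz _ i))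

    y₁≡ : σ-map y₁ ≡ y₁
    y₁≡ = map-tabulate-var σ _ y₁ λ i →
      trans (lookup-++ʳ x _ _) (trans (lookup-++ʳ z₁ _ _)
        (trans (lookup-++ʳ tz _ _) (lookup-++ˡ y₁ _ i)))

    y₂≡ : σ-map y₂ ≡ ty
    y₂≡ = map-tabulate-var σ _ ty λ i →
      trans (lookup-++ʳ x _ _) (trans (lookup-++ʳ z₁ _ _)
        (trans (lookup-++ʳ tz _ _) (lookup-++ʳ y₁ ty i)))

    blocks≡ : ∀ {a b c} (φ : Formula S (a + (b + c)))
              {X X′ : Vec (Term S N) a} {Z Z′ : Vec (Term S N) b} {Y Y′ : Vec (Term S N) c} →
              σ-map X ≡ X′ → σ-map Z ≡ Z′ → σ-map Y ≡ Y′ →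
              sub σ (φ ⟨ X ++ (Z ++ Y) ⟩) ≡ φ ⟨ X′ ++ (Z′ ++ Y′) ⟩
    blocks≡ φ {X} {Z = Z} {Y = Y} refl refl refl = trans (sub-⟨⟩ σ φ (X ++ (Z ++ Y)))
      (cong (φ ⟨_⟩) (trans (map-++ _ X (Z ++ Y)) (cong (σ-map X ++_) (map-++ _ Z Y))))

    δ₁≡ : sub σ (δ₁ ⟨ x ++ (z₁ ++ y₁) ⟩) ≡ δ₁ ⟨ x ++ (z₁ ++ y₁) ⟩
    δ₁≡ = blocks≡ {nx} {nz₁} δ₁ x≡ z₁≡ y₁≡

    δ₂≡ : sub σ (δ₂ ⟨ x ++ (z₂ ++ y₂) ⟩) ≡ δ₂ ⟨ x ++ (tz ++ ty) ⟩
    δ₂≡ = blocks≡ {nx} {nz₂} δ₂ x≡ z₂≡ y₂≡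

  -- Puts a Herbrand disjunct into the shape of the second conjunct in `meet`.
  D-x : ∀ ts → sub σˣ (D ts) ≡
        δ₂ ⟨ x ++ (mapᵛ (subᵗ σˣ) (take nz₂ ts) ++ mapᵛ (subᵗ σˣ) (drop nz₂ ts)) ⟩
  D-x ts = begin
    sub σˣ (D ts)
      ≡⟨ cong (sub σˣ) (sub-swap δ₂ (tabulate var) ts) ⟩
    sub σˣ (δ₂ ⟨ tabulate var ++ ts ⟩)
      ≡⟨ sub-⟨⟩ σˣ δ₂ (tabulate var ++ ts) ⟩
    δ₂ ⟨ mapᵛ (subᵗ σˣ) (tabulate var ++ ts) ⟩
      ≡⟨ cong (δ₂ ⟨_⟩) (trans (map-++ _ (tabulate var) ts)
           (cong₂ _++_ (map-tabulate-var σˣ _ x (λ _ → refl))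
             (trans (cong (mapᵛ _) (sym (take++drop≡id nz₂ ts))) (map-++ _ (take nz₂ ts) _)))) ⟩
    δ₂ ⟨ x ++ (mapᵛ (subᵗ σˣ) (take nz₂ ts) ++ mapᵛ (subᵗ σˣ) (drop nz₂ ts)) ⟩ ∎
    where open ≡-Reasoning

  y₁⊆ : toList y₁ ⊆ toList (y₁ ++ y₂)
  y₁⊆ a∈ = subst (_ ∈_) (sym (toList-++ y₁ y₂)) (∈-++⁺ˡ a∈)

  drop⊆ : ∀ {ts} → ts ∈ tss → toList (mapᵛ (subᵗ σˣ) (drop nz₂ ts)) ⊆ toList (mapᵛ (subᵗ σˣ) v)
  drop⊆ {ts} ts∈
    rewrite toList-map (subᵗ σˣ) v | toList∘fromList vs | toList-map (subᵗ σˣ) (drop nz₂ ts) =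
    map⁺ (subᵗ σˣ) λ a∈ → ∈-concatMap⁺ (toList ∘ drop nz₂) (lose ts∈ a∈)

  witness : χ ∈ map (sub σˣ) (map D tss) →
            T ∣ χ ∷ δ ∷ [] ⊢ (y₁ ++ y₂) ∩ mapᵛ (subᵗ σˣ) v ≠∅
  witness χ∈ with ∈-map⁻ (sub σˣ) χ∈
  ... | _ , D∈ , refl with ∈-map⁻ D D∈
  ... | ts , ts∈ , refl =
    ∩-mono y₁ (mapᵛ (subᵗ σˣ) (drop nz₂ ts)) (y₁ ++ y₂) (mapᵛ (subᵗ σˣ) v) y₁⊆ (drop⊆ ts∈)
    -- Keep the first conjunct of `δ` and replace the second by the Herbrand disjunct at hand;
    -- `meet` then applies to this new conjunction.
    (cut (∧-intro (∧-elimˡ (hyp (there (here refl))))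
                  (⊢-cast (D-x ts) (hyp (here refl))))
         (weaken (∷⁺ʳ _ (λ ())) (meet (mapᵛ (subᵗ σˣ) (take nz₂ ts)) (mapᵛ (subᵗ σˣ) (drop nz₂ ts)))))
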